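{- There is a constant $c>0$ such that for infinitely many positive integers $g$, there exists a graph embeddable on a surface of Euler genus $g$ that has no $\left(0,0,\lfloor c\sqrt{g}\rfloor,\lfloor c\sqrt{g}\rfloor\right)$-coloring.
   Context: All graphs are finite and simple (no loops, no multiple edges). For integers $d_1,\ldots,d_k$, a $(d_1,\ldots,d_k)$-coloring of a graph $G$ is an assignment to each vertex of a color from $\{1,\ldots,k\}$ such that for each $i$, every vertex colored $i$ has at most $d_i$ neighbors colored $i$. A surface is a non-null compact connected 2-manifold without boundary. The Euler genus of a surface is $2h$ if it is the orientable surface obtained from the sphere by adding $h\ge 0$ handles, and $k$ if it is the non-orientable surface obtained from the sphere by adding $k\ge 1$ cross-caps. -}

module Defs where

open import Data.Fin using (Fin)
import Data.Fin.Properties as Fin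
open import Data.Integer using (+_)
open import Data.List using (List; []; _∷_; _++_; [_]; map; concatMap; reverse; zip; filter; length; allFin)
open import Data.List.Membership.Propositional using (_∈_)
open import Data.List.Relation.Binary.Permutation.Propositional using (_↭_)
open import Data.List.Relation.Unary.Any using (Any)
open import Data.Nat using (ℕ; zero; suc; _+_; _*_; _≤_; NonZero; _≟_)
open import Data.Product using (∃-syntax; _×_; _,_)
open import Data.Rational.Unnormalised as ℚᵘ using (ℚᵘ)
open import Data.Vec using (Vec; lookup)
open import Function.Base using (_∘_)
open import Function.Definitions using (Injective)
open import Level using (0ℓ)
open import Relation.Binary.Construct.Closure.Equivalence using (EqClosure)
open import Relation.Binary.Core using (Rel)
open import Relation.Binary.Definitions using (Decidable; Symmetric; Irreflexive)
open import Relation.Binary.PropositionalEquality using (_≡_; _≢_)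
open import Relation.Nullary using (¬_; yes; no)
open import Relation.Nullary.Decidable using (_×-dec_)

------------------------------------------------------------------------
-- Finite simple graphs and defective colorings

record Graph : Set₁ where
  field
    order  : ℕ
    Adj    : Rel (Fin order) 0ℓ
    adj?   : Decidable Adj
    symm   : Symmetric Adj
    irrefl : Irreflexive _≡_ Adj

module _ (G : Graph) where
  open Graph G

  sameColorNeighbors : ∀ {k} → (Fin order → Fin k) → Fin order → List (Fin order)
  sameColorNeighbors col v =
    filter (λ w → adj? v w ×-dec (col w Fin.≟ col v)) (allFin order)

  IsDefectiveColoring : ∀ {k} → Vec ℕ k → (Fin order → Fin k) → Set
  IsDefectiveColoring d col =
    ∀ v → length (sameColorNeighbors col v) ≤ lookup d (col v)

  HasDefectiveColoring : ∀ {k} → Vec ℕ k → Set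
  HasDefectiveColoring {k} d = ∃[ col ] IsDefectiveColoring {k} d col

------------------------------------------------------------------------
-- Polygonal complexes
--
-- Surfaces are handled combinatorially, as finite collections of disjoint
-- polygons whose sides are identified in pairs.  A polygon is the cyclic word
-- read along its boundary; sides with the same label are identified, n ⁻ being
-- the side n ⁺ traversed backwards.

data Side : Set where
  _⁺ _⁻ : ℕ → Side

label : Side → ℕ
label (n ⁺) = n
label (n ⁻) = n

inv : Side → Side
inv (n ⁺) = n ⁻
inv (n ⁻) = n ⁺

Polygon : Set
Polygon = List Side

invPolygon : Polygon → Polygon
invPolygon w = reverse (map inv w)

Complex : Set
Complex = List Polygon

Occurs : ℕ → Complex → Set
Occurs n = Any (Any (λ s → label s ≡ n))

Fresh : ℕ → Complex → Set
Fresh n K = ¬ Occurs n K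

rename : (ℕ → Side) → Side → Side
rename f (n ⁺) = f n
rename f (n ⁻) = inv (f n)

splitSide : (a b c : ℕ) → Side → List Side
splitSide a b c (n ⁺) with n ≟ a
... | yes _ = b ⁺ ∷ c ⁺ ∷ []
... | no  _ = n ⁺ ∷ []
splitSide a b c (n ⁻) with n ≟ a
... | yes _ = c ⁻ ∷ b ⁻ ∷ []
... | no  _ = n ⁻ ∷ []

-- The elementary moves of the combinatorial theory of surfaces.  The first
-- four only change the presentation; `subdivide` inserts a vertex in the
-- interior of an edge, and `cut` inserts a diagonal in a polygon.  All of them
-- preserve the property that every label occurs exactly twice or not at all,
-- which holds for the `standard` complexes below.

data Move : Rel Complex 0ℓ where
  reorder   : ∀ {K L} → K ↭ L → Move K L
  rotate    : ∀ u v {K} → Move ((u ++ v) ∷ K) ((v ++ u) ∷ K)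
  reflect   : ∀ w {K} → Move (w ∷ K) (invPolygon w ∷ K)
  relabel   : ∀ {K} (f : ℕ → Side) → Injective _≡_ _≡_ (label ∘ f) →
              Move K (map (map (rename f)) K)
  subdivide : ∀ {K} a b c → b ≢ c → Fresh b K → Fresh c K →
              Move K (map (concatMap (splitSide a b c)) K)
  cut       : ∀ d u v {K} → u ++ v ≢ [] → Fresh d ((u ++ v) ∷ K) →
              Move ((u ++ v) ∷ K) ((u ++ [ d ⁺ ]) ∷ (d ⁻ ∷ v) ∷ K)

-- By the classification of compact surfaces, two complexes obtained by moves
-- from `standard` ones are related by _≅_ exactly when their underlying
-- surfaces are homeomorphic.

_≅_ : Rel Complex 0ℓ
_≅_ = EqClosure Move

------------------------------------------------------------------------
-- Surfaces

data Surface : Set where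
  orientable    : (h : ℕ) → Surface
  nonOrientable : (k : ℕ) → .{{NonZero k}} → Surface

eulerGenus : Surface → ℕ
eulerGenus (orientable h)    = 2 * h
eulerGenus (nonOrientable k) = k

-- The digon 0 ⁺ 0 ⁻ is a sphere.  Inserting a b a⁻¹ b⁻¹ with fresh a, b at a
-- corner adds a handle, and inserting c c with c fresh adds a cross-cap.

spherePolygon : Polygon
spherePolygon = 0 ⁺ ∷ 0 ⁻ ∷ []

handles : ℕ → Polygon
handles zero    = []
handles (suc h) = handles h ++ (a ⁺ ∷ b ⁺ ∷ a ⁻ ∷ b ⁻ ∷ [])
  where
  a b : ℕ
  a = 1 + 2 * h
  b = 2 + 2 * h

crossCaps : ℕ → Polygon
crossCaps zero    = []
crossCaps (suc k) = crossCaps k ++ (suc k ⁺ ∷ suc k ⁺ ∷ [])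

standard : Surface → Complex
standard (orientable h)    = [ spherePolygon ++ handles h ]
standard (nonOrientable k) = [ spherePolygon ++ crossCaps k ]

------------------------------------------------------------------------
-- Graphs on surfaces

-- Pairs of cyclically consecutive sides.
corners : Polygon → List (Side × Side)
corners []      = []
corners (s ∷ w) = zip (s ∷ w) (w ++ [ s ])

-- Vertices of a complex are represented by directed edges, s standing for its
-- initial point.  At a corner (x , t) the final point of x, which is the
-- initial point of inv x, is glued to the initial point of t.

MeetAtCorner : Complex → Rel Side 0ℓ
MeetAtCorner K s t = Any (λ w → (inv s , t) ∈ corners w) K

SameOrigin : Complex → Rel Side 0ℓ
SameOrigin K = EqClosure (MeetAtCorner K)

-- G is drawn on S when it is a subgraph of the 1-skeleton of some polygonal
-- subdivision of S.  The subdivision may have further vertices and edges, so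
-- the faces of the drawing of G need not be discs and G need not be connected.

record _EmbedsIn_ (G : Graph) (S : Surface) : Set where
  open Graph G
  field
    complex   : Complex
    onSurface : complex ≅ standard S
    at        : Fin order → Side
    at-occurs : ∀ v → Occurs (label (at v)) complex
    at-inj    : ∀ {u v} → SameOrigin complex (at u) (at v) → u ≡ v
    edge      : ∀ {u v} → Adj u v →
                ∃[ e ] Occurs (label e) complex
                     × SameOrigin complex e (at u)
                     × SameOrigin complex (inv e) (at v)

EmbedsInEulerGenus : Graph → ℕ → Set
EmbedsInEulerGenus G g = ∃[ S ] eulerGenus S ≡ g × G EmbedsIn S

------------------------------------------------------------------------
-- Rounding c √g

fromℕ : ℕ → ℚᵘ
fromℕ n = + n ℚᵘ./ 1

-- For c ≥ 0: m ≤ c √g < m + 1, squared to stay within the rationals.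
_≡⌊_√_⌋ : ℕ → ℚᵘ → ℕ → Set
m ≡⌊ c √ g ⌋ = (fromℕ m ℚᵘ.* fromℕ m ℚᵘ.≤ c ℚᵘ.* c ℚᵘ.* fromℕ g)
             × (c ℚᵘ.* c ℚᵘ.* fromℕ g ℚᵘ.< fromℕ (suc m) ℚᵘ.* fromℕ (suc m))

{-# OPTIONS --safe #-}

-- In a complete graph a color class of defect d has at most d + 1 vertices, so the complete graph
-- on n = 3m ≥ 2m + 5 vertices has no (0, 0, m, m)-coloring.  It embeds in the non-orientable
-- surface of genus n² = 9m²: start with a star containing the vertices, in a single polygon with
-- n² cross-caps, and draw one edge for each ordered pair of vertices.  If the polygon reads
-- a b c k k, where k k is a cross-cap, then a k b⁻¹ k c presents the same surface, has the same
-- vertices, and its side k joins the vertex between a and b to the one between b and c.  Hence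
-- c = 1/3.
module Submission where

open import Data.Fin using (Fin; toℕ)
open import Data.Fin.Patterns using (0F; 1F; 2F; 3F)
import Data.Fin.Properties as Fin
import Data.Integer as ℤ
import Data.Integer.Properties as ℤ
open import Data.List using (List; []; _∷_; _++_; [_]; map; concatMap; reverse; zip; length; filter; allFin; cartesianProduct)
open import Data.List.Membership.Propositional using (_∈_)
open import Data.List.Membership.Propositional.Properties using (∈-allFin; ∈-cartesianProduct⁺; ∈-filter⁻)
open import Data.List.Properties using (map-++; reverse-++; reverse-map; reverse-involutive; map-∘; map-id; map-cong; ++-assoc; ++-identityʳ; ++-conicalʳ; length-++; length-map; length-tabulate)
import Data.List.Relation.Binary.Permutation.Propositional as Perm
open import Data.List.Relation.Unary.All as All using (All; []; _∷_)
import Data.List.Relation.Unary.All.Properties as All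
open import Data.List.Relation.Unary.AllPairs using ([]; _∷_)
open import Data.List.Relation.Unary.Any as Any using (Any; here; there)
import Data.List.Relation.Unary.Any.Properties as Any
open import Data.List.Relation.Unary.Unique.Propositional using (Unique)
open import Data.List.Relation.Unary.Unique.Propositional.Properties using (allFin⁺)
open import Data.Nat using (ℕ; zero; suc; _+_; _*_; _≤_; _<_; z≤n; s≤s; _≟_; _⊔_)
open import Data.Nat.Properties
open import Data.Nat.Tactic.RingSolver using (solve-∀)
open import Data.Product using (∃-syntax; _×_; _,_)
open import Data.Rational.Unnormalised as ℚᵘ using (ℚᵘ; Positive; mkℚᵘ; *≡*; *<*)
import Data.Rational.Unnormalised.Properties as ℚᵘ
open import Data.Sum using (_⊎_; inj₁; inj₂)
open import Data.Vec using ([]; _∷_; lookup)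
open import Function.Base using (_∘_; id)
open import Level using (0ℓ)
import Relation.Binary.Construct.Closure.Equivalence as Eq
import Relation.Binary.Construct.On as On
open import Relation.Binary.Core using (Rel; _⇒_)
open import Relation.Binary.PropositionalEquality using (_≡_; _≢_; refl; sym; trans; cong; cong₂; subst; subst₂; ≢-sym; module ≡-Reasoning; isEquivalence)
import Relation.Binary.Reasoning.Setoid as SetoidReasoning
open import Relation.Binary.Structures using (IsEquivalence)
open import Relation.Nullary using (¬_; yes; no; contradiction; ¬?)
open import Relation.Nullary.Decidable using (_×-dec_)
open import Defs

-- Inverse words and fresh labels

Avoids : ℕ → Polygon → Set
Avoids l = All (λ s → label s ≢ l)

inv-involutive : ∀ s → inv (inv s) ≡ s
inv-involutive (n ⁺) = refl
inv-involutive (n ⁻) = refl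

label-inv : ∀ s → label (inv s) ≡ label s
label-inv (n ⁺) = refl
label-inv (n ⁻) = refl

invPolygon-++ : ∀ u v → invPolygon (u ++ v) ≡ invPolygon v ++ invPolygon u
invPolygon-++ u v = trans (cong reverse (map-++ inv u v)) (reverse-++ (map inv u) (map inv v))

invPolygon-involutive : ∀ w → invPolygon (invPolygon w) ≡ w
invPolygon-involutive w = begin
  reverse (map inv (reverse (map inv w))) ≡⟨ cong reverse (reverse-map inv (map inv w)) ⟩
  reverse (reverse (map inv (map inv w))) ≡⟨ reverse-involutive _ ⟩
  map inv (map inv w)                     ≡⟨ map-∘ w ⟨
  map (inv ∘ inv) w                       ≡⟨ map-cong inv-involutive w ⟩
  map id w                                ≡⟨ map-id w ⟩
  w                                       ∎
  where open ≡-Reasoning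

avoids-invPolygon : ∀ {l} w → Avoids l w → Avoids l (invPolygon w)
avoids-invPolygon []      []       = []
avoids-invPolygon (s ∷ w) (p ∷ ps) =
  subst (Avoids _) (sym (invPolygon-++ [ s ] w))
    (All.++⁺ (avoids-invPolygon w ps) ((p ∘ trans (sym (label-inv s))) ∷ []))

-- A threshold gives more than one fresh label: it and its successor are two distinct ones, which
-- the cut-and-glue arguments below require.
∃-avoided : ∀ w → ∃[ n ] ∀ {l} → n ≤ l → Avoids l w
∃-avoided []      = 0 , λ _ → []
∃-avoided (s ∷ w) with ∃-avoided w
... | n , avoids = suc (label s) ⊔ n , λ n≤l →
  <⇒≢ (≤-trans (m≤m⊔n _ n) n≤l) ∷ avoids (≤-trans (m≤n⊔m (suc (label s)) n) n≤l)

fresh : ∀ {l} {K : Complex} → All (Avoids l) K → Fresh l K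
fresh = All.All¬⇒¬Any ∘ All.map All.All¬⇒¬Any

-- Cross-caps in polygons

module ≅-Reasoning = SetoidReasoning (Eq.setoid Move)

move : ∀ {K L} → Move K L → K ≅ L
move = Eq.return

exchange : ∀ u v → (u ∷ v ∷ []) ≅ (v ∷ u ∷ [])
exchange u v = move (reorder (Perm.swap u v Perm.refl))

cutAt : ∀ d u v → u ++ v ≢ [] → Avoids d u → Avoids d v →
        [ u ++ v ] ≅ ((u ++ [ d ⁺ ]) ∷ (d ⁻ ∷ v) ∷ [])
cutAt d u v nonempty au av = move (cut d u v nonempty (fresh (All.++⁺ au av ∷ [])))

-- The cut `d` joins the initial points of the two sides `k ⁺`. Reflecting the half that contains
-- `Y` turns its copy into `k ⁻`, so the halves can be glued along `k`, which is `cut` read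
-- backwards.
crossCap-between : ∀ k d X Y → k ≢ d → Avoids k X → Avoids k Y → Avoids d X → Avoids d Y →
                   [ k ⁺ ∷ X ++ k ⁺ ∷ Y ] ≅ [ X ++ d ⁺ ∷ d ⁺ ∷ invPolygon Y ]
crossCap-between k d X Y k≢d kX kY dX dY = begin
  [ k ⁺ ∷ X ++ k ⁺ ∷ Y ]
    ≈⟨ cutAt d (k ⁺ ∷ X) (k ⁺ ∷ Y) (λ ()) (k≢d ∷ dX) (k≢d ∷ dY) ⟩
  (k ⁺ ∷ X ++ [ d ⁺ ]) ∷ (d ⁻ ∷ k ⁺ ∷ Y) ∷ []
    ≈⟨ move (rotate [ k ⁺ ] (X ++ [ d ⁺ ])) ⟩
  ((X ++ [ d ⁺ ]) ++ [ k ⁺ ]) ∷ (d ⁻ ∷ k ⁺ ∷ Y) ∷ []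
    ≈⟨ exchange _ _ ⟩
  (d ⁻ ∷ k ⁺ ∷ Y) ∷ ((X ++ [ d ⁺ ]) ++ [ k ⁺ ]) ∷ []
    ≈⟨ move (reflect _) ⟩
  invPolygon (d ⁻ ∷ k ⁺ ∷ Y) ∷ ((X ++ [ d ⁺ ]) ++ [ k ⁺ ]) ∷ []
    ≡⟨ cong (_∷ _) (invPolygon-++ (d ⁻ ∷ k ⁺ ∷ []) Y) ⟩
  (invPolygon Y ++ k ⁻ ∷ d ⁺ ∷ []) ∷ ((X ++ [ d ⁺ ]) ++ [ k ⁺ ]) ∷ []
    ≈⟨ move (rotate (invPolygon Y) (k ⁻ ∷ d ⁺ ∷ [])) ⟩
  (k ⁻ ∷ d ⁺ ∷ invPolygon Y) ∷ ((X ++ [ d ⁺ ]) ++ [ k ⁺ ]) ∷ []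
    ≈⟨ exchange _ _ ⟩
  ((X ++ [ d ⁺ ]) ++ [ k ⁺ ]) ∷ (k ⁻ ∷ d ⁺ ∷ invPolygon Y) ∷ []
    ≈⟨ cutAt k (X ++ [ d ⁺ ]) (d ⁺ ∷ invPolygon Y)
         ((λ ()) ∘ ++-conicalʳ (X ++ [ d ⁺ ]) _)
         (All.++⁺ kX (≢-sym k≢d ∷ [])) (≢-sym k≢d ∷ avoids-invPolygon Y kY) ⟨
  [ (X ++ [ d ⁺ ]) ++ d ⁺ ∷ invPolygon Y ]
    ≡⟨ cong [_] (++-assoc X [ d ⁺ ] _) ⟩
  [ X ++ d ⁺ ∷ d ⁺ ∷ invPolygon Y ] ∎
  where open ≅-Reasoning

-- The scheme of `crossCap-between`, with the cut joining the final points of the two sides `e ⁺`.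
-- Cyclically, the pair of sides `d ⁺` therefore lands at the other junction of `X` and the inverse
-- of `Y`.
crossCap-around : ∀ e d X Y → e ≢ d → Avoids e X → Avoids e Y → Avoids d X → Avoids d Y →
                  [ X ++ e ⁺ ∷ Y ++ [ e ⁺ ] ] ≅ [ d ⁺ ∷ X ++ invPolygon Y ++ [ d ⁺ ] ]
crossCap-around e d X Y e≢d eX eY dX dY = begin
  [ X ++ e ⁺ ∷ Y ++ [ e ⁺ ] ]
    ≡⟨ cong [_] (++-assoc X [ e ⁺ ] _) ⟨
  [ (X ++ [ e ⁺ ]) ++ Y ++ [ e ⁺ ] ]
    ≈⟨ cutAt d (X ++ [ e ⁺ ]) (Y ++ [ e ⁺ ])
         ((λ ()) ∘ ++-conicalʳ Y _ ∘ ++-conicalʳ (X ++ [ e ⁺ ]) _)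
         (All.++⁺ dX (e≢d ∷ [])) (All.++⁺ dY (e≢d ∷ [])) ⟩
  ((X ++ [ e ⁺ ]) ++ [ d ⁺ ]) ∷ (d ⁻ ∷ Y ++ [ e ⁺ ]) ∷ []
    ≈⟨ move (rotate (X ++ [ e ⁺ ]) [ d ⁺ ]) ⟩
  (d ⁺ ∷ X ++ [ e ⁺ ]) ∷ (d ⁻ ∷ Y ++ [ e ⁺ ]) ∷ []
    ≈⟨ exchange _ _ ⟩
  (d ⁻ ∷ Y ++ [ e ⁺ ]) ∷ (d ⁺ ∷ X ++ [ e ⁺ ]) ∷ []
    ≈⟨ move (reflect _) ⟩
  invPolygon (d ⁻ ∷ Y ++ [ e ⁺ ]) ∷ (d ⁺ ∷ X ++ [ e ⁺ ]) ∷ []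
    ≡⟨ cong (_∷ _) (trans (invPolygon-++ [ d ⁻ ] (Y ++ [ e ⁺ ]))
                          (cong (_++ [ d ⁺ ]) (invPolygon-++ Y [ e ⁺ ]))) ⟩
  (e ⁻ ∷ invPolygon Y ++ [ d ⁺ ]) ∷ (d ⁺ ∷ X ++ [ e ⁺ ]) ∷ []
    ≈⟨ exchange _ _ ⟩
  (d ⁺ ∷ X ++ [ e ⁺ ]) ∷ (e ⁻ ∷ invPolygon Y ++ [ d ⁺ ]) ∷ []
    ≈⟨ cutAt e (d ⁺ ∷ X) (invPolygon Y ++ [ d ⁺ ]) (λ ())
         (≢-sym e≢d ∷ eX) (All.++⁺ (avoids-invPolygon Y eY) (≢-sym e≢d ∷ [])) ⟨
  [ d ⁺ ∷ X ++ invPolygon Y ++ [ d ⁺ ] ] ∎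
  where open ≅-Reasoning

rotation : ∀ u v → [ u ++ v ] ≅ [ v ++ u ]
rotation u v = move (rotate u v)

-- In cyclic notation: a k b⁻¹ k c ≅ a d d b c ≅ a e c⁻¹b⁻¹ e ≅ a b c k k, where each step cuts along
-- the new label and glues along the old one.
replaceCrossCap : ∀ k a b c → Avoids k a → Avoids k b → Avoids k c →
  [ a ++ k ⁺ ∷ invPolygon b ++ k ⁺ ∷ c ] ≅ [ (a ++ b ++ c) ++ k ⁺ ∷ k ⁺ ∷ [] ]
replaceCrossCap k a b c ka kb kc
  with ∃-avoided (k ⁺ ∷ a ++ b ++ c)
... | d , avoided = begin
  [ a ++ k ⁺ ∷ invPolygon b ++ k ⁺ ∷ c ]
    ≡⟨ cong (λ w → [ a ++ k ⁺ ∷ w ]) (sym (++-assoc (invPolygon b) [ k ⁺ ] c)) ⟩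
  [ a ++ (k ⁺ ∷ invPolygon b ++ [ k ⁺ ]) ++ c ]
    ≡⟨ cong [_] (sym (++-assoc a _ c)) ⟩
  [ (a ++ k ⁺ ∷ invPolygon b ++ [ k ⁺ ]) ++ c ]
    ≈⟨ rotation _ c ⟩
  [ c ++ a ++ k ⁺ ∷ invPolygon b ++ [ k ⁺ ] ]
    ≡⟨ cong [_] (trans (sym (++-assoc c a _)) (sym (++-assoc (c ++ a) (k ⁺ ∷ invPolygon b) _))) ⟩
  [ ((c ++ a) ++ k ⁺ ∷ invPolygon b) ++ [ k ⁺ ] ]
    ≈⟨ rotation _ [ k ⁺ ] ⟩
  [ k ⁺ ∷ (c ++ a) ++ k ⁺ ∷ invPolygon b ]
    ≈⟨ crossCap-between k d (c ++ a) (invPolygon b) k≢d (All.++⁺ kc ka) (avoids-invPolygon b kb)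
         (All.++⁺ dc da) (avoids-invPolygon b db) ⟩
  [ (c ++ a) ++ d ⁺ ∷ d ⁺ ∷ invPolygon (invPolygon b) ]
    ≡⟨ cong [_] (trans (++-assoc c a _) (cong (λ w → c ++ a ++ d ⁺ ∷ d ⁺ ∷ w) (invPolygon-involutive b))) ⟩
  [ c ++ a ++ d ⁺ ∷ d ⁺ ∷ b ]
    ≈⟨ rotation c _ ⟩
  [ (a ++ d ⁺ ∷ d ⁺ ∷ b) ++ c ]
    ≡⟨ cong [_] (++-assoc a _ c) ⟩
  [ a ++ d ⁺ ∷ d ⁺ ∷ b ++ c ]
    ≡⟨ cong (λ w → [ a ++ d ⁺ ∷ d ⁺ ∷ w ]) (sym (invPolygon-involutive (b ++ c))) ⟩
  [ a ++ d ⁺ ∷ d ⁺ ∷ invPolygon (invPolygon (b ++ c)) ]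
    ≈⟨ crossCap-between e d a (invPolygon (b ++ c)) (≢-sym d≢e) ea (avoids-invPolygon _ ebc)
         da (avoids-invPolygon _ (All.++⁺ db dc)) ⟨
  [ e ⁺ ∷ a ++ e ⁺ ∷ invPolygon (b ++ c) ]
    ≈⟨ rotation [ e ⁺ ] _ ⟩
  [ (a ++ e ⁺ ∷ invPolygon (b ++ c)) ++ [ e ⁺ ] ]
    ≡⟨ cong [_] (++-assoc a _ _) ⟩
  [ a ++ e ⁺ ∷ invPolygon (b ++ c) ++ [ e ⁺ ] ]
    ≈⟨ crossCap-around e k a (invPolygon (b ++ c)) (≢-sym k≢e) ea (avoids-invPolygon _ ebc)
         ka (avoids-invPolygon _ (All.++⁺ kb kc)) ⟩
  [ k ⁺ ∷ a ++ invPolygon (invPolygon (b ++ c)) ++ [ k ⁺ ] ]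
    ≡⟨ cong (λ w → [ k ⁺ ∷ a ++ w ++ [ k ⁺ ] ]) (invPolygon-involutive (b ++ c)) ⟩
  [ k ⁺ ∷ a ++ (b ++ c) ++ [ k ⁺ ] ]
    ≡⟨ cong (λ w → [ k ⁺ ∷ w ]) (sym (++-assoc a (b ++ c) _)) ⟩
  [ k ⁺ ∷ (a ++ b ++ c) ++ [ k ⁺ ] ]
    ≈⟨ rotation [ k ⁺ ] _ ⟩
  [ ((a ++ b ++ c) ++ [ k ⁺ ]) ++ [ k ⁺ ] ]
    ≡⟨ cong [_] (++-assoc (a ++ b ++ c) _ _) ⟩
  [ (a ++ b ++ c) ++ k ⁺ ∷ k ⁺ ∷ [] ] ∎
  where
  open ≅-Reasoning
  e = suc d
  dw = avoided ≤-refl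
  ew = avoided (n≤1+n d)
  k≢d = All.head dw
  k≢e = All.head ew
  d≢e : d ≢ e
  d≢e = <⇒≢ ≤-refl
  da = All.++⁻ˡ a (All.tail dw)
  db = All.++⁻ˡ b (All.++⁻ʳ a (All.tail dw))
  dc = All.++⁻ʳ b (All.++⁻ʳ a (All.tail dw))
  ea = All.++⁻ˡ a (All.tail ew)
  ebc = All.++⁻ʳ a (All.tail ew)

-- Dangling edges

splitSide-avoids : ∀ {a b c} w → Avoids a w → concatMap (splitSide a b c) w ≡ w
splitSide-avoids []        []       = refl
splitSide-avoids {a} (n ⁺ ∷ w) (p ∷ ps) with n ≟ a
... | yes n≡a = contradiction n≡a p
... | no  _   = cong (n ⁺ ∷_) (splitSide-avoids w ps)
splitSide-avoids {a} (n ⁻ ∷ w) (p ∷ ps) with n ≟ a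
... | yes n≡a = contradiction n≡a p
... | no  _   = cong (n ⁻ ∷_) (splitSide-avoids w ps)

splitSide-⁺ : ∀ a b c → splitSide a b c (a ⁺) ≡ b ⁺ ∷ c ⁺ ∷ []
splitSide-⁺ a b c with a ≟ a
... | yes _   = refl
... | no  a≢a = contradiction refl a≢a

splitSide-⁻ : ∀ a b c → splitSide a b c (a ⁻) ≡ c ⁻ ∷ b ⁻ ∷ []
splitSide-⁻ a b c with a ≟ a
... | yes _   = refl
... | no  a≢a = contradiction refl a≢a

-- Cutting off the monogon x, subdividing x into d y and gluing along y leaves a dangling edge d.
addSpur : ∀ d w → w ≢ [] → Avoids d w → [ w ] ≅ [ d ⁺ ∷ d ⁻ ∷ w ]
addSpur d w nonempty dw with ∃-avoided (d ⁺ ∷ w)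
... | x , avoided = begin
  [ w ]
    ≈⟨ cutAt x [] w nonempty [] xw ⟩
  [ x ⁺ ] ∷ (x ⁻ ∷ w) ∷ []
    ≈⟨ move (subdivide x d y d≢y
         (fresh ((x≢d ∷ []) ∷ (x≢d ∷ dw) ∷ []))
         (fresh ((x≢y ∷ []) ∷ (x≢y ∷ yw) ∷ []))) ⟩
  (splitSide x d y (x ⁺) ++ []) ∷ (splitSide x d y (x ⁻) ++ concatMap (splitSide x d y) w) ∷ []
    ≡⟨ cong₂ (λ u v → u ∷ v ∷ []) (cong (_++ []) (splitSide-⁺ x d y))
         (cong₂ _++_ (splitSide-⁻ x d y) (splitSide-avoids w xw)) ⟩
  (d ⁺ ∷ y ⁺ ∷ []) ∷ (y ⁻ ∷ d ⁻ ∷ w) ∷ []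
    ≈⟨ cutAt y [ d ⁺ ] (d ⁻ ∷ w) (λ ()) (d≢y ∷ []) (d≢y ∷ yw) ⟨
  [ d ⁺ ∷ d ⁻ ∷ w ] ∎
  where
  open ≅-Reasoning
  y = suc x
  d≢y = All.head (avoided (n≤1+n x))
  x≢d = ≢-sym (All.head (avoided ≤-refl))
  x≢y : x ≢ y
  x≢y = <⇒≢ ≤-refl
  xw = All.tail (avoided ≤-refl)
  yw = All.tail (avoided (n≤1+n x))

-- Closed walks around a polygon

-- R is meant to relate sides with the same origin, so p and q are vertices given by any side
-- starting there.
Path : Rel Side 0ℓ → Side → Polygon → Side → Set
Path R p []      q = R p q
Path R p (s ∷ w) q = R p s × Path R (inv s) w q

PathVia : Rel Side 0ℓ → (p s t q : Side) (a b c : Polygon) → Set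
PathVia R p s t q a b c = Path R p a s × Path R s b t × Path R t c q

Closed : Rel Side 0ℓ → Polygon → Set
Closed R w = ∃[ p ] Path R p w p

path-map : ∀ {R S : Rel Side 0ℓ} → R ⇒ S → ∀ {p q} w → Path R p w q → Path S p w q
path-map f []      r       = f r
path-map f (s ∷ w) (r , P) = f r , path-map f w P

module _ {R : Rel Side 0ℓ} (R-equiv : IsEquivalence R) where
  private module R = IsEquivalence R-equiv

  path-respˡ : ∀ {p p′ q} w → R p′ p → Path R p w q → Path R p′ w q
  path-respˡ []      r P        = R.trans r P
  path-respˡ (s ∷ w) r (r′ , P) = R.trans r r′ , P

  path-respʳ : ∀ {p q q′} w → Path R p w q → R q q′ → Path R p w q′
  path-respʳ []      P       r = R.trans P r
  path-respʳ (s ∷ w) (r′ , P) r = r′ , path-respʳ w P r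

  path-++ : ∀ {p q r} u {v} → Path R p u q → Path R q v r → Path R p (u ++ v) r
  path-++ []      {v} r       Q = path-respˡ v r Q
  path-++ (s ∷ u) (r , P) Q = r , path-++ u P Q

  path-split : ∀ {p r} u {v} → Path R p (u ++ v) r → ∃[ q ] Path R p u q × Path R q v r
  path-split []      P       = _ , R.refl , P
  path-split (s ∷ u) (r , P) with path-split u P
  ... | q , Pu , Pv = q , (r , Pu) , Pv

  path-inv : ∀ {p q} w → Path R p w q → Path R q (invPolygon w) p
  path-inv []      r       = R.sym r
  path-inv {p} {q} (s ∷ w) (r , P) =
    subst (λ x → Path R q x p) (sym (invPolygon-++ [ s ] w))
      (path-++ (invPolygon w) (path-inv w P)
        (R.refl , subst (λ x → R x p) (sym (inv-involutive s)) (R.sym r)))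

  -- The last side of a word fixes where a walk along it ends; only for the empty word does the end
  -- depend on the start.
  path-endpoint : ∀ {p p′ q q′} w → R p p′ → Path R p w q → Path R p′ w q′ → R q q′
  path-endpoint []      r P       Q        = R.trans (R.sym P) (R.trans r Q)
  path-endpoint (s ∷ w) _ (_ , P) (_ , Q) = path-endpoint w R.refl P Q

  path-startpoint : ∀ {p p′ q q′} w → w ≢ [] → Path R p w q → Path R p′ w q′ → R p p′
  path-startpoint []      ne _       _       = contradiction refl ne
  path-startpoint (s ∷ w) _  (r , _) (r′ , _) = R.trans r (R.sym r′)

  -- The final side `y` is arbitrary because the recursion advances the first side while the one
  -- that closes the polygon stays fixed. `corners (s ∷ w)` is the case `y = s`.
  corners-path : ∀ s w y → All (λ (x , t) → R (inv x) t) (zip (s ∷ w) (w ++ [ y ])) → Path R (inv s) w y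
  corners-path s []      y (r ∷ []) = r
  corners-path s (t ∷ w) y (r ∷ rs) = r , corners-path t w y rs

  path-corners : ∀ s w y → Path R (inv s) w y → All (λ (x , t) → R (inv x) t) (zip (s ∷ w) (w ++ [ y ]))
  path-corners s []      y r       = r ∷ []
  path-corners s (t ∷ w) y (r , P) = r ∷ path-corners t w y P

  -- Together with `sameOrigin-closed`, this makes `SameOrigin [ w ]` the least equivalence for
  -- which `w` is a closed walk. To keep two vertices apart it thus suffices to exhibit one such
  -- equivalence that separates them.
  sameOrigin⇒ : ∀ w → Closed R w → SameOrigin [ w ] ⇒ R
  sameOrigin⇒ w closed = Eq.fold R-equiv (λ where (here m) → meets w closed m)
    where
    meets : ∀ w → Closed R w → ∀ {s t} → (inv s , t) ∈ corners w → R s t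
    meets (x ∷ w) (p , r , P) {s} {t} m =
      subst (λ y → R y t) (inv-involutive s)
        (All.lookup (path-corners x w x (path-respʳ w P r)) m)

SameOrigin-equiv : ∀ K → IsEquivalence (SameOrigin K)
SameOrigin-equiv K = Eq.isEquivalence (MeetAtCorner K)

sameOrigin-closed : ∀ s w → Path (SameOrigin [ s ∷ w ]) s (s ∷ w) s
sameOrigin-closed s w = IsEquivalence.refl E ,
  corners-path E s w s (All.tabulate λ {(x , t)} m →
    Eq.return (here (subst (λ y → (y , t) ∈ corners (s ∷ w)) (sym (inv-involutive x)) m)))
  where E = SameOrigin-equiv [ s ∷ w ]

sameLabel : ∀ s t → label s ≡ label t → s ≡ t ⊎ inv s ≡ t
sameLabel (n ⁺) (_ ⁺) refl = inj₁ refl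
sameLabel (n ⁺) (_ ⁻) refl = inj₂ refl
sameLabel (n ⁻) (_ ⁺) refl = inj₂ refl
sameLabel (n ⁻) (_ ⁻) refl = inj₁ refl

OccursIn : ℕ → Polygon → Set
OccursIn l = Any (λ s → label s ≡ l)

-- A polygon passes through the origin of each of its sides, whether it traverses that side
-- forwards or backwards.
splitAt : ∀ {R} → IsEquivalence R → ∀ {p q} w s → Path R p w q → OccursIn (label s) w →
          ∃[ u ] ∃[ v ] w ≡ u ++ v × Path R p u s × Path R s v q
splitAt E (x ∷ w) s (r , P) (here same) with sameLabel x s same
... | inj₁ refl = [] , x ∷ w , refl , r , IsEquivalence.refl E , P
... | inj₂ refl = [ x ] , w , refl , (r , IsEquivalence.refl E) , P
splitAt E (x ∷ w) s (r , P) (there o) with splitAt E w s P o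
... | u , v , refl , Pu , Pv = x ∷ u , v , refl , (r , Pu) , Pv

-- After the split at `s`, finding the label of `t` in the first or in the second part decides which
-- of the two origins is listed first. The case `s ≡ t` is allowed, so loops can be drawn too.
splitAt₂ : ∀ {R} → IsEquivalence R → ∀ {p q} w s t → Path R p w q →
           OccursIn (label s) w → OccursIn (label t) w →
           ∃[ a ] ∃[ b ] ∃[ c ] w ≡ a ++ b ++ c ×
             (PathVia R p s t q a b c ⊎ PathVia R p t s q a b c)
splitAt₂ E w s t P os ot with splitAt E w s P os
... | u , v , refl , Pu , Pv with Any.++⁻ u ot
...   | inj₁ otu with splitAt E u t Pu otu
...     | a , b , refl , Pa , Pb = a , b , v , ++-assoc a b v , inj₂ (Pa , Pb , Pv)
splitAt₂ E w s t P os ot | u , v , refl , Pu , Pv | inj₂ otv with splitAt E v t Pv otv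
...     | b , c , refl , Pb , Pc = u , b , c , refl , inj₁ (Pu , Pb , Pc)

avoids⇒≢ : ∀ {l l′ w} → Avoids l w → OccursIn l′ w → l′ ≢ l
avoids⇒≢ (p ∷ _)  (here refl) = p
avoids⇒≢ (_ ∷ ps) (there o)   = avoids⇒≢ ps o

-- An edge added along a cross-cap

-- If `b` runs from s to t, the new word goes along `k` from s to t, back along `b` to s, and along
-- `k` to t again. So `k` joins s to t, and `a` and `c` still end and start where they did.
addEdge : ℕ → Polygon → Polygon → Polygon → Polygon
addEdge k a b c = a ++ k ⁺ ∷ invPolygon b ++ k ⁺ ∷ c

avoids-addEdge : ∀ {l k} a b c → k ≢ l → Avoids l (a ++ b ++ c) → Avoids l (addEdge k a b c)
avoids-addEdge a b c k≢l av =
  All.++⁺ (All.++⁻ˡ a av) (k≢l ∷ All.++⁺ (avoids-invPolygon b (All.++⁻ˡ b bc)) (k≢l ∷ All.++⁻ʳ b bc))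
  where bc = All.++⁻ʳ a av

occurs-invPolygon : ∀ {l} w → OccursIn l w → OccursIn l (invPolygon w)
occurs-invPolygon w o = Any.reverse⁺ (Any.map⁺ (Any.map (λ {s} → trans (label-inv s)) o))

occurs-addEdge : ∀ {l k} a b c → OccursIn l (a ++ b ++ c) → OccursIn l (addEdge k a b c)
occurs-addEdge a b c o with Any.++⁻ a o
... | inj₁ oa = Any.++⁺ˡ oa
... | inj₂ obc with Any.++⁻ b obc
...   | inj₁ ob = Any.++⁺ʳ a (there (Any.++⁺ˡ (occurs-invPolygon b ob)))
...   | inj₂ oc = Any.++⁺ʳ a (there (Any.++⁺ʳ (invPolygon b) (there oc)))

module _ (k : ℕ) (a b c : Polygon) where
  private
    w w′ : Polygon
    w  = a ++ b ++ c
    w′ = addEdge k a b c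
    E  = SameOrigin-equiv [ w ]
    E′ = SameOrigin-equiv [ w′ ]
    _∼_ = SameOrigin [ w ]
    _∼′_ = SameOrigin [ w′ ]

  -- The closed walk around `w′` is split at the two copies of `k ⁺`. Its middle piece reads `b`
  -- backwards, from the final point of `k` to its initial point, and is inverted.
  addEdge-paths : ∃[ q ] Path _∼′_ q a (k ⁺) × Path _∼′_ (k ⁺) b (k ⁻) × Path _∼′_ (k ⁻) c q
  addEdge-paths with addEdge-closed a
    where
    -- `sameOrigin-closed` needs an explicit first side: that of `a`, or `k ⁺` if `a` is empty.
    addEdge-closed : ∀ a → Closed (SameOrigin [ addEdge k a b c ]) (addEdge k a b c)
    addEdge-closed []      = _ , sameOrigin-closed _ _
    addEdge-closed (_ ∷ _) = _ , sameOrigin-closed _ _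
  ... | q , P with path-split E′ a P
  ... | r , Pa , r∼k , Q with path-split E′ (invPolygon b) Q
  ... | r′ , Pb , r′∼k , Pc = q , path-respʳ E′ a Pa r∼k ,
    subst (λ x → Path _∼′_ (k ⁺) x (k ⁻)) (invPolygon-involutive b)
      (path-inv E′ (invPolygon b) (path-respʳ E′ (invPolygon b) Pb r′∼k)) , Pc

  -- The three walks compose to a closed walk along `w` under `_∼′_`, and `_∼_` is the least
  -- equivalence that admits one.
  addEdge-preserves : _∼_ ⇒ _∼′_
  addEdge-preserves with addEdge-paths
  ... | q , Pa , Pb , Pc =
    sameOrigin⇒ E′ w (q , path-++ E′ a Pa (path-++ E′ b Pb Pc))

  module _ {p s t} (Pa : Path _∼_ p a s) (Pb : Path _∼_ s b t) (Pc : Path _∼_ t c p) where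

    -- Under `_∼′_` there are two walks along each of `a` and `b`, one from `addEdge-paths` and one
    -- lifted from the old polygon. They follow the same sides, hence end at the same vertices. For
    -- empty `a` the starting points matter, and the first side of `w` identifies those.
    addEdge-ends : w ≢ [] → (k ⁺) ∼′ s × (k ⁻) ∼′ t
    addEdge-ends nonempty with addEdge-paths
    ... | q , Qa , Qb , Qc = k∼s , k∼t
      where
      lift : ∀ {x y} v → Path _∼_ x v y → Path _∼′_ x v y
      lift = path-map addEdge-preserves
      q∼p = path-startpoint E′ w nonempty (path-++ E′ a Qa (path-++ E′ b Qb Qc))
              (path-++ E′ a (lift a Pa) (path-++ E′ b (lift b Pb) (lift c Pc)))
      k∼s = path-endpoint E′ a q∼p Qa (lift a Pa)
      k∼t = path-endpoint E′ b k∼s Qb (lift b Pb)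

    -- The new edge is collapsed onto the origins s and t of sides of the old polygon.
    addEdge-reflects : Avoids k w → label p ≢ k → ∀ {x y} → label x ≢ k → label y ≢ k → x ∼′ y → x ∼ y
    addEdge-reflects kw p≢k {x} {y} x≢k y≢k x∼y = subst₂ _∼_ (ρ-old x x≢k) (ρ-old y y≢k)
      (sameOrigin⇒ R-equiv w′ (p , closed) x∼y)
      where
      ρ : Side → Side
      ρ (n ⁺) with n ≟ k
      ... | yes _ = s
      ... | no  _ = n ⁺
      ρ (n ⁻) with n ≟ k
      ... | yes _ = t
      ... | no  _ = n ⁻

      ρ-old : ∀ x → label x ≢ k → ρ x ≡ x
      ρ-old (n ⁺) n≢k with n ≟ k
      ... | yes n≡k = contradiction n≡k n≢k
      ... | no  _   = refl
      ρ-old (n ⁻) n≢k with n ≟ k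
      ... | yes n≡k = contradiction n≡k n≢k
      ... | no  _   = refl

      ρ-k⁺ : ρ (k ⁺) ≡ s
      ρ-k⁺ with k ≟ k
      ... | yes _   = refl
      ... | no  k≢k = contradiction refl k≢k

      ρ-k⁻ : ρ (k ⁻) ≡ t
      ρ-k⁻ with k ≟ k
      ... | yes _   = refl
      ... | no  k≢k = contradiction refl k≢k

      R : Rel Side 0ℓ
      R x y = ρ x ∼ ρ y

      R-equiv : IsEquivalence R
      R-equiv = On.isEquivalence ρ E

      transport : ∀ {x y x′ y′} v → Avoids k v → ρ x′ ≡ x → ρ y′ ≡ y → Path _∼_ x v y → Path R x′ v y′
      transport []      []       refl refl r       = r
      transport (z ∷ v) (z≢k ∷ vk) refl y≡ (r , P) =
        subst (_ ∼_) (sym (ρ-old z z≢k)) r ,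
        transport v vk (ρ-old (inv z) (z≢k ∘ trans (sym (label-inv z)))) y≡ P

      R-refl = IsEquivalence.refl E

      -- Read through `ρ`, the walk follows `a` from `p` to `s`, `k` to `t`, `b` backwards to `s`,
      -- `k` to `t` again, and `c` back to `p`.
      closed : Path R p w′ p
      closed =
        path-++ R-equiv {q = k ⁺} a
          (transport a (All.++⁻ˡ a kw) (ρ-old p p≢k) ρ-k⁺ Pa)
          (R-refl , path-++ R-equiv {q = k ⁺} (invPolygon b)
            (path-inv R-equiv b (transport b (All.++⁻ˡ b (All.++⁻ʳ a kw)) ρ-k⁺ ρ-k⁻ Pb))
            (R-refl , transport c (All.++⁻ʳ b (All.++⁻ʳ a kw)) ρ-k⁻ (ρ-old p p≢k) Pc))

-- Drawings in a single polygon, one edge at a time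

record Drawing {n} (at : Fin n → Side) (es : List (Fin n × Fin n)) (w : Polygon) : Set where
  field
    at-occurs : ∀ v → OccursIn (label (at v)) w
    at-inj    : ∀ {u v} → SameOrigin [ w ] (at u) (at v) → u ≡ v
    edge      : ∀ {u v} → (u , v) ∈ es →
                ∃[ e ] OccursIn (label e) w
                     × SameOrigin [ w ] e (at u)
                     × SameOrigin [ w ] (inv e) (at v)

module _ {n} {at : Fin n → Side} {es : List (Fin n × Fin n)} where

  module _ {k p a b c} (D : Drawing at es (a ++ b ++ c))
           (kw : Avoids k (a ++ b ++ c)) (p≢k : label p ≢ k) where
    open Drawing D
    private
      w = a ++ b ++ c

    extendDrawing : ∀ {s t} → PathVia (SameOrigin [ w ]) p s t p a b c → ∀ {u v} e → label e ≡ k →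
      SameOrigin [ addEdge k a b c ] e (at u) → SameOrigin [ addEdge k a b c ] (inv e) (at v) →
      Drawing at ((u , v) ∷ es) (addEdge k a b c)
    extendDrawing (Pa , Pb , Pc) e refl eu ev = record
      { at-occurs = λ v → occurs-addEdge a b c (at-occurs v)
      ; at-inj    = λ {u} {v} → at-inj ∘
          addEdge-reflects k a b c Pa Pb Pc kw p≢k (avoids⇒≢ kw (at-occurs u)) (avoids⇒≢ kw (at-occurs v))
      ; edge      = λ where
          (here refl) → e , Any.++⁺ʳ a (here refl) , eu , ev
          (there m)   → let (e , o , x , y) = edge m in
            e , occurs-addEdge a b c o , addEdge-preserves k a b c x , addEdge-preserves k a b c y
      }

    drawBetween : w ≢ [] → ∀ u v →
      PathVia (SameOrigin [ w ]) p (at u) (at v) p a b c ⊎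
      PathVia (SameOrigin [ w ]) p (at v) (at u) p a b c →
      Drawing at ((u , v) ∷ es) (addEdge k a b c)
    drawBetween nonempty u v (inj₁ paths@(Pa , Pb , Pc)) =
      let ku , kv = addEdge-ends k a b c Pa Pb Pc nonempty in
      extendDrawing paths (k ⁺) refl ku kv
    -- Here `b` runs from `at v` to `at u`, so the edge from `u` to `v` is `k` traversed backwards.
    drawBetween nonempty u v (inj₂ paths@(Pa , Pb , Pc)) =
      let kv , ku = addEdge-ends k a b c Pa Pb Pc nonempty in
      extendDrawing paths (k ⁻) refl ku kv

  drawEdge : ∀ {w k} → Drawing at es w → Avoids k w → ∀ u v →
    ∃[ a ] ∃[ b ] ∃[ c ] w ≡ a ++ b ++ c × Drawing at ((u , v) ∷ es) (addEdge k a b c)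
  drawEdge {[]} D _ u v with () ← Drawing.at-occurs D u
  drawEdge {x ∷ w} {k} D kw u v
    with splitAt₂ (SameOrigin-equiv [ x ∷ w ]) (x ∷ w) (at u) (at v) (sameOrigin-closed x w)
           (Drawing.at-occurs D u) (Drawing.at-occurs D v)
  ... | a , b , c , eq , paths = a , b , c , eq , drawn eq D kw (All.head kw) (λ ()) paths
    where
    -- The word is generalised to a variable, since `x ∷ w ≡ a ++ b ++ c` cannot be matched with
    -- `refl` directly.
    drawn : ∀ {w} → w ≡ a ++ b ++ c → Drawing at es w → Avoids k w → label x ≢ k → w ≢ [] →
      PathVia (SameOrigin [ w ]) x (at u) (at v) x a b c ⊎
      PathVia (SameOrigin [ w ]) x (at v) (at u) x a b c →
      Drawing at ((u , v) ∷ es) (addEdge k a b c)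
    drawn refl D kw x≢k nonempty paths = drawBetween D kw x≢k nonempty u v paths

avoids-crossCaps : ∀ {l} j → j < l → Avoids l (crossCaps j)
avoids-crossCaps zero    _   = []
avoids-crossCaps (suc j) j<l =
  All.++⁺ (avoids-crossCaps j (≤-trans (n≤1+n _) j<l)) (<⇒≢ j<l ∷ <⇒≢ j<l ∷ [])

-- Each edge consumes one cross-cap, and `j` counts those left over. The tail of the list is drawn
-- first and leaves `suc j`; the last of these, with label `suc j`, then becomes the edge for the
-- head. The avoidance clause keeps the labels of the remaining cross-caps out of the drawing.
drawEdges : ∀ {n} {at : Fin n → Side} es j {w} → Drawing at [] w →
  (∀ {l} → 1 ≤ l → l ≤ length es + j → Avoids l w) →
  ∃[ w′ ] Drawing at es w′ × [ w ++ crossCaps (length es + j) ] ≅ [ w′ ++ crossCaps j ] ×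
    (∀ {l} → 1 ≤ l → l ≤ j → Avoids l w′)
drawEdges []             j {w} D avoids = w , D , Eq.reflexive Move , avoids
drawEdges ((u , v) ∷ es) j {w} D avoids
  with drawEdges es (suc j) D (λ 1≤l l≤ → avoids 1≤l (≤-trans l≤ (≤-reflexive (+-suc (length es) j))))
... | w′ , D′ , w≅w′ , avoids′ with drawEdge D′ (avoids′ (s≤s z≤n) ≤-refl) u v
... | a , b , c , refl , D″ = addEdge k a b c , D″ , equivalence ,
    λ 1≤l l≤j → avoids-addEdge a b c (≢-sym (<⇒≢ (s≤s l≤j))) (avoids′ 1≤l (≤-trans l≤j (n≤1+n j)))
  where
  k = suc j
  kw = avoids′ (s≤s z≤n) ≤-refl
  open ≅-Reasoning
  equivalence : [ w ++ crossCaps (suc (length es + j)) ] ≅ [ addEdge k a b c ++ crossCaps j ]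
  equivalence = begin
    [ w ++ crossCaps (suc (length es + j)) ]
      ≡⟨ cong (λ m → [ w ++ crossCaps m ]) (sym (+-suc (length es) j)) ⟩
    [ w ++ crossCaps (length es + suc j) ]
      ≈⟨ w≅w′ ⟩
    [ (a ++ b ++ c) ++ crossCaps j ++ k ⁺ ∷ k ⁺ ∷ [] ]
      ≡⟨ cong [_] (trans (sym (++-assoc (a ++ b ++ c) (crossCaps j) _))
           (cong (_++ k ⁺ ∷ k ⁺ ∷ []) (trans (++-assoc a (b ++ c) _) (cong (a ++_) (++-assoc b c _))))) ⟩
    [ (a ++ b ++ c ++ crossCaps j) ++ k ⁺ ∷ k ⁺ ∷ [] ]
      -- The remaining cross-caps are absorbed into the third factor, which puts the pair of sides
      -- `k ⁺` at the end of the word.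
      ≈⟨ replaceCrossCap k a b (c ++ crossCaps j) (All.++⁻ˡ a kw) (All.++⁻ˡ b (All.++⁻ʳ a kw))
           (All.++⁺ (All.++⁻ʳ b (All.++⁻ʳ a kw)) (avoids-crossCaps j ≤-refl)) ⟨
    [ a ++ k ⁺ ∷ invPolygon b ++ k ⁺ ∷ c ++ crossCaps j ]
      ≡⟨ cong [_] (trans (++-assoc a _ _) (cong (λ w → a ++ k ⁺ ∷ w) (++-assoc (invPolygon b) _ _))) ⟨
    [ addEdge k a b c ++ crossCaps j ] ∎

-- Complete graphs on non-orientable surfaces

-- 0 is the edge of spherePolygon, and 1, …, g are the labels of crossCaps g.
spur : ℕ → ℕ → ℕ
spur g zero    = 0
spur g (suc i) = suc (g + i)

spur-injective : ∀ g {i j} → spur g i ≡ spur g j → i ≡ j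
spur-injective g {zero}  {zero}  _  = refl
spur-injective g {suc i} {suc j} eq = cong suc (+-cancelˡ-≡ g i j (suc-injective eq))

spur-avoids : ∀ {g l} i → 1 ≤ l → l ≤ g → spur g i ≢ l
spur-avoids zero    ()  _   refl
spur-avoids (suc i) 1≤l l≤g refl = 1+n≰n (≤-trans (s≤s (m≤m+n _ i)) l≤g)

-- Every edge is traversed out from a common centre and straight back, the digon `spherePolygon`
-- being the edge of index 0. The sides `spur g i ⁻` start at the tips, which serve as the vertices
-- of the graph.
star : ℕ → ℕ → Polygon
star g zero    = spherePolygon
star g (suc i) = spur g (suc i) ⁺ ∷ spur g (suc i) ⁻ ∷ star g i

avoids-star : ∀ {g l} i → (∀ {j} → j ≤ i → spur g j ≢ l) → Avoids l (star g i)
avoids-star zero    f = f z≤n ∷ f z≤n ∷ []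
avoids-star (suc i) f = f ≤-refl ∷ f ≤-refl ∷ avoids-star i (f ∘ m≤n⇒m≤1+n)

occurs-star : ∀ {g j} i → j ≤ i → OccursIn (spur g j) (star g i)
occurs-star zero    z≤n = here refl
occurs-star {j = j} (suc i) j≤i with j ≟ suc i
... | yes refl = here refl
... | no  j≢i  = there (there (occurs-star i (≤-pred (≤∧≢⇒< j≤i j≢i))))

star-≅ : ∀ g i → [ spherePolygon ++ crossCaps g ] ≅ [ star g i ++ crossCaps g ]
star-≅ g zero    = Eq.reflexive Move
star-≅ g (suc i) = Eq.transitive Move (star-≅ g i)
  (addSpur (spur g (suc i)) (star g i ++ crossCaps g) (nonempty i)
    (All.++⁺ (avoids-star i λ j≤i eq → 1+n≰n (subst (_≤ i) (spur-injective g eq) j≤i))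
             (avoids-crossCaps g (s≤s (m≤m+n g i)))))
  where
  nonempty : ∀ i → star g i ++ crossCaps g ≢ []
  nonempty zero    ()
  nonempty (suc _) ()

-- Tips are told apart by `sameOrigin⇒`: give the centre height 0 and the tip of the edge labelled
-- `l` height `suc l`. Equality of heights closes up the star, because each edge leaves the centre
-- and returns to it from its own tip.
starDrawing : ∀ g n → Drawing {suc n} (λ v → spur g (toℕ v) ⁻) [] (star g n)
starDrawing g n = record
  { at-occurs = λ v → occurs-star n (≤-pred (Fin.toℕ<n v))
  ; at-inj    = λ eq → Fin.toℕ-injective (spur-injective g (suc-injective
                  (sameOrigin⇒ E (star g n) (0 ⁺ , closed n) eq)))
  ; edge      = λ ()
  }
  where
  height : Side → ℕ
  height (_ ⁺) = 0
  height (l ⁻) = suc l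

  E : IsEquivalence (λ s t → height s ≡ height t)
  E = On.isEquivalence height isEquivalence

  closed : ∀ n → Path (λ s t → height s ≡ height t) (0 ⁺) (star g n) (0 ⁺)
  closed zero    = refl , refl , refl
  closed (suc n) = refl , refl , path-respˡ E (star g n) refl (closed n)

complete : ℕ → Graph
complete n = record
  { order  = n
  ; Adj    = _≢_
  ; adj?   = λ u v → ¬? (u Fin.≟ v)
  ; symm   = ≢-sym
  ; irrefl = contradiction
  }

length-cartesianProduct : ∀ {A B : Set} (xs : List A) (ys : List B) →
  length (cartesianProduct xs ys) ≡ length xs * length ys
length-cartesianProduct []       ys = refl
length-cartesianProduct (x ∷ xs) ys =
  trans (length-++ (map (x ,_) ys)) (cong₂ _+_ (length-map (x ,_) ys) (length-cartesianProduct xs ys))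

complete-embeds : ∀ n → complete (suc n) EmbedsIn nonOrientable (suc n * suc n)
complete-embeds n = embedding (drawEdges es 0 (starDrawing g n)
    (λ 1≤l l≤g → avoids-star n (λ {j} _ → spur-avoids j 1≤l (≤-trans l≤g (≤-reflexive length≡g)))))
  where
  g = suc n * suc n
  -- Both orders and the diagonal are included, so the number of edges drawn is exactly `g`; loops
  -- and parallel edges are legitimate in a complex.
  es = cartesianProduct (allFin (suc n)) (allFin (suc n))
  length≡g : length es + 0 ≡ g
  length≡g = trans (+-identityʳ _) (trans (length-cartesianProduct (allFin (suc n)) (allFin (suc n)))
    (cong₂ _*_ (length-tabulate {n = suc n} id) (length-tabulate {n = suc n} id)))

  at : Fin (suc n) → Side
  at v = spur g (toℕ v) ⁻

  embedding : ∃[ w ] Drawing at es w × [ star g n ++ crossCaps (length es + 0) ] ≅ [ w ++ [] ] ×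
    (∀ {l} → 1 ≤ l → l ≤ 0 → Avoids l w) → complete (suc n) EmbedsIn nonOrientable g
  embedding (w , D , star≅w , _) = record
    { complex   = [ w ]
    ; onSurface = Eq.symmetric Move (subst₂ (λ m w → [ spherePolygon ++ crossCaps m ] ≅ [ w ]) length≡g (++-identityʳ w)
                    (Eq.transitive Move
                      (subst (λ m → [ spherePolygon ++ crossCaps m ] ≅ [ star g n ++ crossCaps m ])
                        (sym length≡g) (star-≅ g n))
                      star≅w))
    ; at        = at
    ; at-occurs = here ∘ at-occurs
    ; at-inj    = at-inj
    ; edge      = λ {u} {v} _ →
        let e , o , x , y = edge (∈-cartesianProduct⁺ (∈-allFin u) (∈-allFin v))
        in e , here o , x , y
    }
    where open Drawing D

-- Defective colorings of complete graphs

count : ∀ {n} → (Fin n → Fin 4) → Fin 4 → List (Fin n) → ℕ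
count col c xs = length (filter (λ w → col w Fin.≟ c) xs)

count-total : ∀ {n} (col : Fin n → Fin 4) xs →
  length xs ≡ count col 0F xs + count col 1F xs + count col 2F xs + count col 3F xs
count-total col []       = refl
count-total col (x ∷ xs) with count-total col xs | col x
... | total | 0F = cong suc total
... | total | 1F = trans (cong suc total) (suc-second (count col 0F xs) (count col 1F xs) _ _)
  where
  suc-second : ∀ a b c d → suc (a + b + c + d) ≡ a + suc b + c + d
  suc-second = solve-∀
... | total | 2F = trans (cong suc total) (suc-third (count col 0F xs + count col 1F xs) (count col 2F xs) _)
  where
  suc-third : ∀ a b c → suc (a + b + c) ≡ a + suc b + c
  suc-third = solve-∀
... | total | 3F = trans (cong suc total) (sym (+-suc _ _))

module _ {n} (col : Fin n → Fin 4) (v : Fin n) where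
  private
    P? = λ w → col w Fin.≟ col v
    Q? = λ w → ¬? (v Fin.≟ w) ×-dec (col w Fin.≟ col v)

  count-others : ∀ xs → All (v ≢_) xs → length (filter P? xs) ≤ length (filter Q? xs)
  count-others []       []       = z≤n
  count-others (x ∷ xs) (v≢x ∷ v≢xs) with v Fin.≟ x | P? x
  ... | yes v≡x | _     = contradiction v≡x v≢x
  ... | no  _   | yes _ = s≤s (count-others xs v≢xs)
  ... | no  _   | no  _ = count-others xs v≢xs

  -- In a complete graph `Q?` selects the neighbors of `v` in its own color, so the two lists differ
  -- only by `v`, which a list without repetitions contains at most once.
  count-neighbors : ∀ xs → Unique xs → length (filter P? xs) ≤ suc (length (filter Q? xs))
  count-neighbors []       []       = z≤n
  count-neighbors (x ∷ xs) (x∉xs ∷ uniq) with v Fin.≟ x | P? x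
  ... | yes refl | yes _ = s≤s (count-others xs x∉xs)
  ... | yes refl | no ¬p = contradiction refl ¬p
  ... | no  _    | yes _ = s≤s (count-neighbors xs uniq)
  ... | no  _    | no  _ = count-neighbors xs uniq

-- A nonempty color class has a member `v`, and all other members are neighbors of `v` in its color,
-- so the defect at `v` bounds the whole class.
count-defective : ∀ {n d} (col : Fin n → Fin 4) → IsDefectiveColoring (complete n) d col →
  ∀ c → count col c (allFin n) ≤ suc (lookup d c)
count-defective {n} {d} col defective c with filter (λ w → col w Fin.≟ c) (allFin n) in eq
... | []    = z≤n
... | v ∷ vs with ∈-filter⁻ (λ w → col w Fin.≟ c) {xs = allFin n} (subst (v ∈_) (sym eq) (here refl))
... | _ , refl = subst (λ xs → length xs ≤ suc (lookup d (col v))) eq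
  (≤-trans (count-neighbors col v (allFin n) (allFin⁺ n)) (s≤s (defective v)))

complete-uncolorable : ∀ {n m} → 4 + (m + m) < n → ¬ HasDefectiveColoring (complete n) (0 ∷ 0 ∷ m ∷ m ∷ [])
complete-uncolorable {n} {m} large (col , defective) = <⇒≱ large (begin
  n                          ≡⟨ length-tabulate {n = n} id ⟨
  length (allFin n)          ≡⟨ count-total col (allFin n) ⟩
  size 0F + size 1F + size 2F + size 3F
                             ≤⟨ +-mono-≤ (+-mono-≤ (+-mono-≤ (bound 0F) (bound 1F)) (bound 2F)) (bound 3F) ⟩
  1 + 1 + suc m + suc m      ≡⟨ cong (3 +_) (+-suc m m) ⟩
  4 + (m + m)                ∎)
  where
  open ≤-Reasoning
  size = λ c → count col c (allFin n)
  bound = count-defective {d = 0 ∷ 0 ∷ m ∷ m ∷ []} col defective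

-- The constant and the sequence of genera

⅓ : ℚᵘ
-- `mkℚᵘ` takes the denominator minus one.
⅓ = mkℚᵘ (ℤ.+ 1) 2

-- One third of the root of (3m)² is exactly m, so the lower bound is an equality and the upper one
-- is m² < (m + 1)².
⌊⅓√⌋ : ∀ m → m ≡⌊ ⅓ √ (3 * m) * (3 * m) ⌋
⌊⅓√⌋ m = ℚᵘ.≤-reflexive (ℚᵘ.≃-sym scaled) , ℚᵘ.<-respˡ-≃ (ℚᵘ.≃-sym scaled) square-<
  where
  square : ∀ k → (ℤ.+ k ℤ.* ℤ.+ k) ℤ.* ℤ.+ 1 ≡ ℤ.+ (k * k)
  square k = trans (ℤ.*-identityʳ _) (sym (ℤ.pos-* k k))

  square-< : fromℕ m ℚᵘ.* fromℕ m ℚᵘ.< fromℕ (suc m) ℚᵘ.* fromℕ (suc m)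
  square-< = *<* (subst₂ ℤ._<_ (sym (square m)) (sym (square (suc m))) (ℤ.+<+ (*-mono-< (n<1+n m) (n<1+n m))))

  scaled : ⅓ ℚᵘ.* ⅓ ℚᵘ.* fromℕ ((3 * m) * (3 * m)) ℚᵘ.≃ fromℕ m ℚᵘ.* fromℕ m
  scaled = *≡* (begin
    (ℤ.+ 1 ℤ.* ℤ.+ ((3 * m) * (3 * m))) ℤ.* ℤ.+ 1
      ≡⟨ trans (ℤ.*-identityʳ _) (ℤ.*-identityˡ _) ⟩
    ℤ.+ ((3 * m) * (3 * m))
      ≡⟨ cong ℤ.+_ (rearrange m) ⟩
    ℤ.+ ((m * m) * 9)
      ≡⟨ trans (ℤ.pos-* (m * m) 9) (cong (ℤ._* ℤ.+ 9) (ℤ.pos-* m m)) ⟩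
    (ℤ.+ m ℤ.* ℤ.+ m) ℤ.* ℤ.+ 9 ∎)
    where
    open ≡-Reasoning
    rearrange : ∀ m → (3 * m) * (3 * m) ≡ (m * m) * 9
    rearrange = solve-∀

mainTheorem10 : ∃[ c ] Positive c ×
    (∀ (N : ℕ) → ∃[ g ] N < g ×
    (∃[ m ] m ≡⌊ c √ g ⌋ ×
    (∃[ G ] EmbedsInEulerGenus G g ×
    ¬ HasDefectiveColoring G (0 ∷ 0 ∷ m ∷ m ∷ []))))
mainTheorem10 = ⅓ , _ , λ N →
  -- The inequality 2m + 4 < 3m holds from m = 5 on; adding `N` makes the genus exceed `N`.
  let m = 5 + N
      n = 3 * m
  in n * n , large N , m , ⌊⅓√⌋ m , complete n ,
     (nonOrientable (n * n) , refl , complete-embeds _) , complete-uncolorable (order N)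
  where
  large : ∀ N → N < (3 * (5 + N)) * (3 * (5 + N))
  large N = ≤-trans (s≤s (m≤n+m N 4)) (≤-trans (m≤m+n (5 + N) _) (m≤m*n (3 * (5 + N)) (3 * (5 + N))))

  order : ∀ N → 4 + ((5 + N) + (5 + N)) < 3 * (5 + N)
  order N = subst (4 + ((5 + N) + (5 + N)) <_) (sym (split N)) (m≤m+n _ N)
    where
    split : ∀ N → 3 * (5 + N) ≡ suc (4 + ((5 + N) + (5 + N))) + N
    split = solve-∀
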